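{- Let $p = 2$ and let $q$ be an odd prime number. Then the energy of the line graph $L(\Gamma(\mathbb{Z}_{2q}))$ is $2q-4$.
   Context: For a positive integer $n$, $\mathbb{Z}_n$ is the ring of residue classes modulo $n$. The zero-divisor graph $\Gamma(\mathbb{Z}_n)$ is the simple undirected graph whose vertices are the nonzero zero-divisors of $\mathbb{Z}_n$ (nonzero $x \in \mathbb{Z}_n$ such that $xy = 0$ for some nonzero $y \in \mathbb{Z}_n$), with distinct vertices $x,y$ adjacent if and only if $xy=0$. The line graph $L(\Gamma(\mathbb{Z}_n))$ is the graph whose vertices are the edges of $\Gamma(\mathbb{Z}_n)$, two distinct vertices being adjacent if the corresponding edges share a common vertex in $\Gamma(\mathbb{Z}_n)$. The energy of a finite graph is the sum of the absolute values of the eigenvalues (counted with multiplicity) of its adjacency matrix. -}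

module Defs where

open import Algebra.Bundles using (RawRing; CommutativeRing)
open import Algebra.Definitions using (Congruent₁; Congruent₂)
import Algebra.Definitions.RawMonoid as RawMonoidOps
import Algebra.Definitions.RawSemiring as RawSemiringOps
open import Data.Bool.Base using (if_then_else_)
open import Data.Fin.Base using (Fin; zero; suc; toℕ; punchIn)
import Data.Fin.Properties as Fin
open import Data.Integer.Base as ℤ using (ℤ; +_)
open import Data.Integer.Divisibility.Signed as ℤ∣ using (_∣_)
import Data.Integer.Properties as ℤ
import Data.Integer.Solver as ℤ-Solver
open import Data.Nat.Base as ℕ using (ℕ; zero; suc)
import Data.Nat.Properties as ℕ
open import Data.Product.Base using (∃-syntax; Σ-syntax; _×_; _,_; proj₁)
open import Data.Rational.Base as ℚ using (ℚ; 0ℚ; 1ℚ; ½)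
import Data.Rational.Properties as ℚ
import Data.Rational.Solver as ℚ-Solver
open import Data.Sum.Base using (_⊎_; inj₁; inj₂)
open import Data.Vec.Functional using (Vector)
open import Function.Bundles using (Inverse)
open import Level using (0ℓ)
open import Relation.Binary.Bundles using (DecSetoid)
open import Relation.Binary.Core using (Rel)
open import Relation.Binary.Definitions
  using (Decidable; Irreflexive; Symmetric; _Respects₂_)
import Relation.Binary.Construct.On as On
open import Relation.Binary.PropositionalEquality
  using (_≡_; refl; sym; trans; cong; subst)
  renaming (setoid to ≡-setoid)
open import Relation.Nullary using (¬_; does)
open import Relation.Nullary.Decidable using (map′; _×-dec_; _⊎-dec_; ¬?)

-- The reals are Cauchy sequences of rationals modulo null sequences, with
-- pointwise operations.
IsCauchy : (ℕ → ℚ) → Set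
IsCauchy s = ∀ (ε : ℚ) → 0ℚ ℚ.< ε →
  ∃[ N ] (∀ m n → N ℕ.≤ m → N ℕ.≤ n → ℚ.∣ s m ℚ.- s n ∣ ℚ.< ε)

record ℝ : Set where
  constructor mkℝ
  field
    seq    : ℕ → ℚ
    cauchy : IsCauchy seq

open ℝ public

infix 4 _≈ℝ_
_≈ℝ_ : Rel ℝ 0ℓ
x ≈ℝ y = ∀ (ε : ℚ) → 0ℚ ℚ.< ε →
  ∃[ N ] (∀ n → N ℕ.≤ n → ℚ.∣ seq x n ℚ.- seq y n ∣ ℚ.< ε)

private
  half-pos : ∀ {ε} → 0ℚ ℚ.< ε → 0ℚ ℚ.< ½ ℚ.* ε
  half-pos {ε} 0<ε = subst (ℚ._< ½ ℚ.* ε) (ℚ.*-zeroʳ ½) (ℚ.*-monoʳ-<-pos ½ 0<ε)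

  half+half : ∀ ε → ½ ℚ.* ε ℚ.+ ½ ℚ.* ε ≡ ε
  half+half ε = trans (sym (ℚ.*-distribʳ-+ ε ½ ½)) (ℚ.*-identityˡ ε)

  ⊔-left : ∀ {a b m} → a ℕ.⊔ b ℕ.≤ m → a ℕ.≤ m
  ⊔-left {a} {b} = ℕ.≤-trans (ℕ.m≤m⊔n a b)

  ⊔-right : ∀ {a b m} → a ℕ.⊔ b ℕ.≤ m → b ℕ.≤ m
  ⊔-right {a} {b} = ℕ.≤-trans (ℕ.m≤n⊔m a b)

  const-cauchy : ∀ p → IsCauchy (λ _ → p)
  const-cauchy p ε 0<ε =
    0 , λ _ _ _ _ → subst (λ d → ℚ.∣ d ∣ ℚ.< ε) (sym (ℚ.+-inverseʳ p)) 0<ε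

  +-cauchy : ∀ {s t} → IsCauchy s → IsCauchy t → IsCauchy (λ n → s n ℚ.+ t n)
  +-cauchy {s} {t} cs ct ε 0<ε
    with cs (½ ℚ.* ε) (half-pos 0<ε) | ct (½ ℚ.* ε) (half-pos 0<ε)
  ... | N , hs | M , ht = N ℕ.⊔ M , λ m n m≥ n≥ → begin-strict
      ℚ.∣ (s m ℚ.+ t m) ℚ.- (s n ℚ.+ t n) ∣
        ≡⟨ cong ℚ.∣_∣ (lem (s m) (t m) (s n) (t n)) ⟩
      ℚ.∣ (s m ℚ.- s n) ℚ.+ (t m ℚ.- t n) ∣
        ≤⟨ ℚ.∣p+q∣≤∣p∣+∣q∣ (s m ℚ.- s n) (t m ℚ.- t n) ⟩
      ℚ.∣ s m ℚ.- s n ∣ ℚ.+ ℚ.∣ t m ℚ.- t n ∣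
        <⟨ ℚ.+-mono-< (hs m n (⊔-left m≥) (⊔-left n≥))
                      (ht m n (⊔-right {N} m≥) (⊔-right {N} n≥)) ⟩
      ½ ℚ.* ε ℚ.+ ½ ℚ.* ε
        ≡⟨ half+half ε ⟩
      ε ∎
    where
    open ℚ.≤-Reasoning
    open ℚ-Solver.+-*-Solver
    lem : ∀ a b c d → (a ℚ.+ b) ℚ.- (c ℚ.+ d) ≡ (a ℚ.- c) ℚ.+ (b ℚ.- d)
    lem = solve 4 (λ a b c d → (a :+ b) :- (c :+ d) := (a :- c) :+ (b :- d)) refl

  neg-cauchy : ∀ {s} → IsCauchy s → IsCauchy (λ n → ℚ.- s n)
  neg-cauchy {s} cs ε 0<ε with cs ε 0<ε
  ... | N , hs = N , λ m n m≥ n≥ →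
      subst (ℚ._< ε)
        (trans (sym (ℚ.∣-p∣≡∣p∣ (s m ℚ.- s n))) (cong ℚ.∣_∣ (lem (s m) (s n))))
        (hs m n m≥ n≥)
    where
    open ℚ-Solver.+-*-Solver
    lem : ∀ a b → ℚ.- (a ℚ.- b) ≡ (ℚ.- a) ℚ.- (ℚ.- b)
    lem = solve 2 (λ a b → :- (a :- b) := (:- a) :- (:- b)) refl

  ∣a∣≤∣a-b∣+∣b∣ : ∀ a b → ℚ.∣ a ∣ ℚ.≤ ℚ.∣ a ℚ.- b ∣ ℚ.+ ℚ.∣ b ∣
  ∣a∣≤∣a-b∣+∣b∣ a b =
    subst (λ c → ℚ.∣ c ∣ ℚ.≤ ℚ.∣ a ℚ.- b ∣ ℚ.+ ℚ.∣ b ∣) (lem a b)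
      (ℚ.∣p+q∣≤∣p∣+∣q∣ (a ℚ.- b) b)
    where
    open ℚ-Solver.+-*-Solver
    lem : ∀ a b → (a ℚ.- b) ℚ.+ b ≡ a
    lem = solve 2 (λ a b → (a :- b) :+ b := a) refl

  ∣a∣-∣b∣≤∣a-b∣ : ∀ a b → ℚ.∣ a ∣ ℚ.- ℚ.∣ b ∣ ℚ.≤ ℚ.∣ a ℚ.- b ∣
  ∣a∣-∣b∣≤∣a-b∣ a b =
    subst (ℚ.∣ a ∣ ℚ.- ℚ.∣ b ∣ ℚ.≤_) (lem ℚ.∣ a ℚ.- b ∣ ℚ.∣ b ∣)
      (ℚ.+-monoˡ-≤ (ℚ.- ℚ.∣ b ∣) (∣a∣≤∣a-b∣+∣b∣ a b))
    where
    open ℚ-Solver.+-*-Solver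
    lem : ∀ a b → (a ℚ.+ b) ℚ.- b ≡ a
    lem = solve 2 (λ a b → (a :+ b) :- b := a) refl

  ∣a-b∣≡∣b-a∣ : ∀ a b → ℚ.∣ a ℚ.- b ∣ ≡ ℚ.∣ b ℚ.- a ∣
  ∣a-b∣≡∣b-a∣ a b = trans (cong ℚ.∣_∣ (lem a b)) (ℚ.∣-p∣≡∣p∣ (b ℚ.- a))
    where
    open ℚ-Solver.+-*-Solver
    lem : ∀ a b → a ℚ.- b ≡ ℚ.- (b ℚ.- a)
    lem = solve 2 (λ a b → a :- b := :- (b :- a)) refl

  abs-cauchy : ∀ {s} → IsCauchy s → IsCauchy (λ n → ℚ.∣ s n ∣)
  abs-cauchy {s} cs ε 0<ε with cs ε 0<ε
  ... | N , hs = N , λ m n m≥ n≥ →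
      ℚ.≤-<-trans (reverse-triangle (s m) (s n)) (hs m n m≥ n≥)
    where
    reverse-triangle : ∀ a b → ℚ.∣ ℚ.∣ a ∣ ℚ.- ℚ.∣ b ∣ ∣ ℚ.≤ ℚ.∣ a ℚ.- b ∣
    reverse-triangle a b with ℚ.∣p∣≡p∨∣p∣≡-p (ℚ.∣ a ∣ ℚ.- ℚ.∣ b ∣)
    ... | inj₁ eq = subst (ℚ._≤ ℚ.∣ a ℚ.- b ∣) (sym eq) (∣a∣-∣b∣≤∣a-b∣ a b)
    ... | inj₂ eq = subst (ℚ._≤ ℚ.∣ a ℚ.- b ∣) (sym (trans eq (lem ℚ.∣ a ∣ ℚ.∣ b ∣)))
                      (subst (ℚ.∣ b ∣ ℚ.- ℚ.∣ a ∣ ℚ.≤_) (∣a-b∣≡∣b-a∣ b a)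
                        (∣a∣-∣b∣≤∣a-b∣ b a))
      where
      open ℚ-Solver.+-*-Solver
      lem : ∀ a b → ℚ.- (a ℚ.- b) ≡ b ℚ.- a
      lem = solve 2 (λ a b → :- (a :- b) := b :- a) refl

  eventually-bounded : ∀ {s} → IsCauchy s →
    ∃[ B ] (0ℚ ℚ.< B × ∃[ N ] (∀ n → N ℕ.≤ n → ℚ.∣ s n ∣ ℚ.≤ B))
  eventually-bounded {s} cs = bound 1ℚ (ℚ.positive⁻¹ 1ℚ)
    where
    bound : ∀ u → 0ℚ ℚ.< u →
      ∃[ B ] (0ℚ ℚ.< B × ∃[ N ] (∀ n → N ℕ.≤ n → ℚ.∣ s n ∣ ℚ.≤ B))
    bound u 0<u with cs u 0<u
    ... | N , hs =
        u ℚ.+ ℚ.∣ s N ∣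
      , ℚ.<-≤-trans 0<u (subst (ℚ._≤ u ℚ.+ ℚ.∣ s N ∣) (ℚ.+-identityʳ u)
                          (ℚ.+-monoʳ-≤ u (ℚ.0≤∣p∣ (s N))))
      , N
      , λ n n≥ → ℚ.≤-trans (∣a∣≤∣a-b∣+∣b∣ (s n) (s N))
                   (ℚ.+-monoˡ-≤ ℚ.∣ s N ∣ (ℚ.<⇒≤ (hs n N n≥ ℕ.≤-refl)))

  share : ∀ S → 0ℚ ℚ.< S → ∀ ε → 0ℚ ℚ.< ε → ∃[ δ ] (0ℚ ℚ.< δ × S ℚ.* δ ≡ ε)
  share S 0<S ε 0<ε = S⁻¹ ℚ.* ε , 0<δ , Sδ≡ε
    where
    S-pos : ℚ.Positive S
    S-pos = ℚ.positive 0<S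
    S-nonZero : ℚ.NonZero S
    S-nonZero = ℚ.pos⇒nonZero S {{S-pos}}
    S⁻¹ : ℚ
    S⁻¹ = ℚ.1/_ S {{S-nonZero}}
    0<δ : 0ℚ ℚ.< S⁻¹ ℚ.* ε
    0<δ = subst (ℚ._< S⁻¹ ℚ.* ε) (ℚ.*-zeroʳ S⁻¹)
            (ℚ.*-monoʳ-<-pos S⁻¹ {{ℚ.1/pos⇒pos S {{S-pos}}}} 0<ε)
    Sδ≡ε : S ℚ.* (S⁻¹ ℚ.* ε) ≡ ε
    Sδ≡ε = trans (sym (ℚ.*-assoc S S⁻¹ ε))
          (trans (cong (ℚ._* ε) (ℚ.*-inverseʳ S {{S-nonZero}})) (ℚ.*-identityˡ ε))

  ∣a*d∣<E*δ : ∀ a d E δ → 0ℚ ℚ.< E →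
              ℚ.∣ a ∣ ℚ.≤ E → ℚ.∣ d ∣ ℚ.< δ → ℚ.∣ a ℚ.* d ∣ ℚ.< E ℚ.* δ
  ∣a*d∣<E*δ a d E δ 0<E a≤E d<δ =
    subst (ℚ._< E ℚ.* δ) (sym (ℚ.∣p*q∣≡∣p∣*∣q∣ a d))
      (ℚ.≤-<-trans
        (ℚ.*-monoʳ-≤-nonNeg ℚ.∣ d ∣ {{ℚ.nonNegative (ℚ.0≤∣p∣ d)}} a≤E)
        (ℚ.*-monoʳ-<-pos E {{ℚ.positive 0<E}} d<δ))

  ∣ab-cd∣<[B+C]*δ : ∀ a b c d B C δ → 0ℚ ℚ.< B → 0ℚ ℚ.< C →
    ℚ.∣ a ∣ ℚ.≤ B → ℚ.∣ d ∣ ℚ.≤ C → ℚ.∣ b ℚ.- d ∣ ℚ.< δ → ℚ.∣ a ℚ.- c ∣ ℚ.< δ →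
    ℚ.∣ a ℚ.* b ℚ.- c ℚ.* d ∣ ℚ.< (B ℚ.+ C) ℚ.* δ
  ∣ab-cd∣<[B+C]*δ a b c d B C δ 0<B 0<C a≤B d≤C b-d<δ a-c<δ = begin-strict
      ℚ.∣ a ℚ.* b ℚ.- c ℚ.* d ∣
        ≡⟨ cong ℚ.∣_∣ (split a b c d) ⟩
      ℚ.∣ a ℚ.* (b ℚ.- d) ℚ.+ d ℚ.* (a ℚ.- c) ∣
        ≤⟨ ℚ.∣p+q∣≤∣p∣+∣q∣ (a ℚ.* (b ℚ.- d)) (d ℚ.* (a ℚ.- c)) ⟩
      ℚ.∣ a ℚ.* (b ℚ.- d) ∣ ℚ.+ ℚ.∣ d ℚ.* (a ℚ.- c) ∣
        <⟨ ℚ.+-mono-< (∣a*d∣<E*δ a (b ℚ.- d) B δ 0<B a≤B b-d<δ)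
                      (∣a*d∣<E*δ d (a ℚ.- c) C δ 0<C d≤C a-c<δ) ⟩
      B ℚ.* δ ℚ.+ C ℚ.* δ
        ≡⟨ sym (ℚ.*-distribʳ-+ δ B C) ⟩
      (B ℚ.+ C) ℚ.* δ ∎
    where
    open ℚ.≤-Reasoning
    open ℚ-Solver.+-*-Solver
    split : ∀ a b c d →
      (a ℚ.* b) ℚ.- (c ℚ.* d) ≡ a ℚ.* (b ℚ.- d) ℚ.+ d ℚ.* (a ℚ.- c)
    split = solve 4 (λ a b c d →
      (a :* b) :- (c :* d) := a :* (b :- d) :+ d :* (a :- c)) refl

  0<B+C : ∀ B C → 0ℚ ℚ.< B → 0ℚ ℚ.< C → 0ℚ ℚ.< B ℚ.+ C
  0<B+C B C 0<B 0<C =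
    ℚ.<-trans 0<B (subst (ℚ._< B ℚ.+ C) (ℚ.+-identityʳ B) (ℚ.+-monoʳ-< B 0<C))

  *-tail : ∀ (s t : ℕ → ℚ) ε B C δ K L N M →
    0ℚ ℚ.< B → 0ℚ ℚ.< C → (B ℚ.+ C) ℚ.* δ ≡ ε →
    (∀ n → K ℕ.≤ n → ℚ.∣ s n ∣ ℚ.≤ B) →
    (∀ n → L ℕ.≤ n → ℚ.∣ t n ∣ ℚ.≤ C) →
    (∀ m n → N ℕ.≤ m → N ℕ.≤ n → ℚ.∣ s m ℚ.- s n ∣ ℚ.< δ) →
    (∀ m n → M ℕ.≤ m → M ℕ.≤ n → ℚ.∣ t m ℚ.- t n ∣ ℚ.< δ) →
    ∀ m n → (K ℕ.⊔ L) ℕ.⊔ (N ℕ.⊔ M) ℕ.≤ m → (K ℕ.⊔ L) ℕ.⊔ (N ℕ.⊔ M) ℕ.≤ n →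
    ℚ.∣ s m ℚ.* t m ℚ.- s n ℚ.* t n ∣ ℚ.< ε
  *-tail s t ε B C δ K L N M 0<B 0<C [B+C]δ≡ε bs bt hs ht m n m≥ n≥ =
    subst (ℚ.∣ s m ℚ.* t m ℚ.- s n ℚ.* t n ∣ ℚ.<_) [B+C]δ≡ε
      (∣ab-cd∣<[B+C]*δ (s m) (t m) (s n) (t n) B C δ 0<B 0<C
        (bs m (⊔-left {K} {L} (⊔-left {K ℕ.⊔ L} {N ℕ.⊔ M} m≥)))
        (bt n (⊔-right {K} {L} (⊔-left {K ℕ.⊔ L} {N ℕ.⊔ M} n≥)))
        (ht m n (⊔-right {N} {M} (⊔-right {K ℕ.⊔ L} {N ℕ.⊔ M} m≥))
                (⊔-right {N} {M} (⊔-right {K ℕ.⊔ L} {N ℕ.⊔ M} n≥)))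
        (hs m n (⊔-left {N} {M} (⊔-right {K ℕ.⊔ L} {N ℕ.⊔ M} m≥))
                (⊔-left {N} {M} (⊔-right {K ℕ.⊔ L} {N ℕ.⊔ M} n≥))))

  *-cauchy : ∀ {s t} → IsCauchy s → IsCauchy t → IsCauchy (λ n → s n ℚ.* t n)
  *-cauchy {s} {t} cs ct ε 0<ε =
    let B , 0<B , K , bs = eventually-bounded {s} cs
        C , 0<C , L , bt = eventually-bounded {t} ct
        δ , 0<δ , eq     = share (B ℚ.+ C) (0<B+C B C 0<B 0<C) ε 0<ε
        N , hs           = cs δ 0<δ
        M , ht           = ct δ 0<δ
    in (K ℕ.⊔ L) ℕ.⊔ (N ℕ.⊔ M)
     , *-tail s t ε B C δ K L N M 0<B 0<C eq bs bt hs ht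

fromℚ : ℚ → ℝ
fromℚ p = mkℝ (λ _ → p) (const-cauchy p)

fromℤ : ℤ → ℝ
fromℤ i = fromℚ (i ℚ./ 1)

infixl 6 _+ℝ_ _-ℝ_
infixl 7 _*ℝ_
infix  8 -ℝ_

_+ℝ_ : ℝ → ℝ → ℝ
x +ℝ y = mkℝ (λ n → seq x n ℚ.+ seq y n) (+-cauchy {seq x} {seq y} (cauchy x) (cauchy y))

_*ℝ_ : ℝ → ℝ → ℝ
x *ℝ y = mkℝ (λ n → seq x n ℚ.* seq y n) (*-cauchy {seq x} {seq y} (cauchy x) (cauchy y))

-ℝ_ : ℝ → ℝ
-ℝ x = mkℝ (λ n → ℚ.- seq x n) (neg-cauchy {seq x} (cauchy x))

_-ℝ_ : ℝ → ℝ → ℝ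
x -ℝ y = x +ℝ (-ℝ y)

∣_∣ℝ : ℝ → ℝ
∣ x ∣ℝ = mkℝ (λ n → ℚ.∣ seq x n ∣) (abs-cauchy {seq x} (cauchy x))

0ℝ 1ℝ : ℝ
0ℝ = fromℚ 0ℚ
1ℝ = fromℚ 1ℚ

ℝ-rawRing : RawRing 0ℓ 0ℓ
ℝ-rawRing = record
  { Carrier = ℝ ; _≈_ = _≈ℝ_ ; _+_ = _+ℝ_ ; _*_ = _*ℝ_ ; -_ = -ℝ_
  ; 0# = 0ℝ ; 1# = 1ℝ }

module MatrixOps {c ℓ} (R : RawRing c ℓ) where
  open RawRing R
  open RawMonoidOps +-rawMonoid public using (sum)
  open RawMonoidOps *-rawMonoid public using () renaming (sum to product)
  open RawSemiringOps rawSemiring using (_^_)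

  Matrix : ℕ → Set c
  Matrix n = Fin n → Fin n → Carrier

  minor : ∀ {n} → Matrix (suc n) → Fin (suc n) → Matrix n
  minor M j i k = M (suc i) (punchIn j k)

  -- Laplace expansion along the first row.
  det : ∀ {n} → Matrix n → Carrier
  det {zero}  M = 1#
  det {suc n} M = sum (λ j → (- 1#) ^ toℕ j * (M zero j * det (minor M j)))

  identity : ∀ {n} → Matrix n
  identity i j = if does (i Fin.≟ j) then 1# else 0#

  charMatrix : ∀ {n} → Matrix n → Carrier → Matrix n
  charMatrix A x i j = x * identity i j + (- A i j)

open MatrixOps ℝ-rawRing public

-- The entries of ev are the eigenvalues of A, listed with multiplicity:
-- det (xI − A) = ∏ᵢ (x − evᵢ).  The two sides are compared as functions of
-- x; ℝ being infinite, this is equality of polynomials, and so it determines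
-- ev up to order.
AreEigenvalues : ∀ {n} → Matrix n → Vector ℝ n → Set
AreEigenvalues A ev =
  ∀ (x : ℝ) → det (charMatrix A x) ≈ℝ product (λ i → x -ℝ ev i)

-- The vertices form a setoid, so that quotients (residue classes, unordered
-- pairs) can serve as vertex sets; decidability makes the entries of the
-- adjacency matrix computable.
record Graph : Set₁ where
  field
    vertices : DecSetoid 0ℓ 0ℓ
  open DecSetoid vertices public
    using () renaming (Carrier to V; _≈_ to _≈ᵥ_; _≟_ to _≟ᵥ_)
  field
    _~_    : Rel V 0ℓ
    _~?_   : Decidable _~_
    ~-resp : _~_ Respects₂ _≈ᵥ_
    ~-sym  : Symmetric _~_
    irrefl : Irreflexive _≈ᵥ_ _~_

-- A graph has n vertices when they can be enumerated by Fin n without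
-- repetition up to _≈ᵥ_.
Enumeration : Graph → ℕ → Set
Enumeration G n = Inverse (≡-setoid (Fin n)) (DecSetoid.setoid (Graph.vertices G))

adjacencyMatrix : ∀ (G : Graph) {n} → Enumeration G n → Matrix n
adjacencyMatrix G enum i j = if does (to i ~? to j) then 1ℝ else 0ℝ
  where
  open Graph G
  open Inverse enum

-- G is finite and its energy is E.  The choice of enumeration is immaterial,
-- since another one conjugates the adjacency matrix by a permutation.
HasEnergy : Graph → ℝ → Set
HasEnergy G E =
  ∃[ n ] Σ[ enum ∈ Enumeration G n ] Σ[ ev ∈ Vector ℝ n ]
    AreEigenvalues (adjacencyMatrix G enum) ev × (sum (λ i → ∣ ev i ∣ℝ) ≈ℝ E)

module _ (G : Graph) where
  open Graph G
  private module V = DecSetoid vertices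

  record Edge : Set where
    constructor edge
    field
      end₁ end₂ : V
      adjacent  : end₁ ~ end₂

  open Edge

  -- Edges are unordered pairs.
  _≈ₑ_ : Rel Edge 0ℓ
  e ≈ₑ f = (end₁ e ≈ᵥ end₁ f × end₂ e ≈ᵥ end₂ f)
         ⊎ (end₁ e ≈ᵥ end₂ f × end₂ e ≈ᵥ end₁ f)

  _∈ₑ_ : V → Edge → Set
  w ∈ₑ e = w ≈ᵥ end₁ e ⊎ w ≈ᵥ end₂ e

  ShareVertex : Rel Edge 0ℓ
  ShareVertex e f = ∃[ w ] (w ∈ₑ e × w ∈ₑ f)

  private
    ≈ₑ-sym : Symmetric _≈ₑ_
    ≈ₑ-sym (inj₁ (p , q)) = inj₁ (V.sym p , V.sym q)
    ≈ₑ-sym (inj₂ (p , q)) = inj₂ (V.sym q , V.sym p)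

    ≈ₑ-trans : ∀ {e f g} → e ≈ₑ f → f ≈ₑ g → e ≈ₑ g
    ≈ₑ-trans (inj₁ (p , q)) (inj₁ (r , s)) = inj₁ (V.trans p r , V.trans q s)
    ≈ₑ-trans (inj₁ (p , q)) (inj₂ (r , s)) = inj₂ (V.trans p r , V.trans q s)
    ≈ₑ-trans (inj₂ (p , q)) (inj₁ (r , s)) = inj₂ (V.trans p s , V.trans q r)
    ≈ₑ-trans (inj₂ (p , q)) (inj₂ (r , s)) = inj₁ (V.trans p s , V.trans q r)

    _≟ₑ_ : Decidable _≈ₑ_
    e ≟ₑ f = ((end₁ e ≟ᵥ end₁ f) ×-dec (end₂ e ≟ᵥ end₂ f))
       ⊎-dec ((end₁ e ≟ᵥ end₂ f) ×-dec (end₂ e ≟ᵥ end₁ f))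

    ∈ₑ-respˡ : ∀ {v w e} → v ≈ᵥ w → w ∈ₑ e → v ∈ₑ e
    ∈ₑ-respˡ v≈w (inj₁ p) = inj₁ (V.trans v≈w p)
    ∈ₑ-respˡ v≈w (inj₂ p) = inj₂ (V.trans v≈w p)

    ∈ₑ-respʳ : ∀ {w e f} → e ≈ₑ f → w ∈ₑ e → w ∈ₑ f
    ∈ₑ-respʳ (inj₁ (p , q)) (inj₁ r) = inj₁ (V.trans r p)
    ∈ₑ-respʳ (inj₁ (p , q)) (inj₂ r) = inj₂ (V.trans r q)
    ∈ₑ-respʳ (inj₂ (p , q)) (inj₁ r) = inj₂ (V.trans r p)
    ∈ₑ-respʳ (inj₂ (p , q)) (inj₂ r) = inj₁ (V.trans r q)

    _∈ₑ?_ : Decidable _∈ₑ_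
    w ∈ₑ? e = (w ≟ᵥ end₁ e) ⊎-dec (w ≟ᵥ end₂ e)

    shareVertex? : Decidable ShareVertex
    shareVertex? e f = map′ to from ((end₁ e ∈ₑ? f) ⊎-dec (end₂ e ∈ₑ? f))
      where
      to : end₁ e ∈ₑ f ⊎ end₂ e ∈ₑ f → ShareVertex e f
      to (inj₁ p) = end₁ e , inj₁ V.refl , p
      to (inj₂ p) = end₂ e , inj₂ V.refl , p
      from : ShareVertex e f → end₁ e ∈ₑ f ⊎ end₂ e ∈ₑ f
      from (w , inj₁ p , q) = inj₁ (∈ₑ-respˡ {e = f} (V.sym p) q)
      from (w , inj₂ p , q) = inj₂ (∈ₑ-respˡ {e = f} (V.sym p) q)

  lineGraph : Graph
  lineGraph = record
    { vertices = record
      { Carrier = Edge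
      ; _≈_ = _≈ₑ_
      ; isDecEquivalence = record
        { isEquivalence = record
          { refl  = inj₁ (V.refl , V.refl)
          ; sym   = λ {e} {f} → ≈ₑ-sym {e} {f}
          ; trans = λ {e} {f} {g} → ≈ₑ-trans {e} {f} {g}
          }
        ; _≟_ = _≟ₑ_
        }
      }
    ; _~_    = λ e f → ¬ (e ≈ₑ f) × ShareVertex e f
    ; _~?_   = λ e f → ¬? (e ≟ₑ f) ×-dec shareVertex? e f
    ; ~-resp =
        (λ {e} {f} {g} f≈g (e≉f , w , w∈e , w∈f) →
          (λ e≈g → e≉f (≈ₑ-trans {e} {g} {f} e≈g (≈ₑ-sym {f} {g} f≈g)))
          , w , w∈e , ∈ₑ-respʳ {w} {f} {g} f≈g w∈f)
      , (λ {g} {e} {f} e≈f (e≉g , w , w∈e , w∈g) →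
          (λ f≈g → e≉g (≈ₑ-trans {e} {f} {g} e≈f f≈g))
          , w , ∈ₑ-respʳ {w} {e} {f} e≈f w∈e , w∈g)
    ; ~-sym  = λ {e} {f} (e≉f , w , w∈e , w∈f) →
        (λ f≈e → e≉f (≈ₑ-sym {f} {e} f≈e)) , w , w∈f , w∈e
    ; irrefl = λ e≈f (e≉f , _) → e≉f e≈f
    }

module _ (R : CommutativeRing 0ℓ 0ℓ)
         (_≟_ : Decidable (CommutativeRing._≈_ R)) where
  private module R = CommutativeRing R
  open R using (Carrier; _≈_; _≉_; _*_; 0#)

  IsNonzeroZeroDivisor : Carrier → Set
  IsNonzeroZeroDivisor x = x ≉ 0# × ∃[ y ] (y ≉ 0# × x * y ≈ 0#)

  private
    ringDecSetoid : DecSetoid 0ℓ 0ℓ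
    ringDecSetoid = record
      { isDecEquivalence = record { isEquivalence = R.isEquivalence ; _≟_ = _≟_ } }

  zeroDivisorGraph : Graph
  zeroDivisorGraph = record
    { vertices = On.decSetoid ringDecSetoid (proj₁ {B = IsNonzeroZeroDivisor})
    ; _~_    = λ (x , _) (y , _) → x ≉ y × x * y ≈ 0#
    ; _~?_   = λ (x , _) (y , _) → ¬? (x ≟ y) ×-dec ((x * y) ≟ 0#)
    ; ~-resp =
        (λ y≈z (x≉y , xy≈0) →
          (λ x≈z → x≉y (R.trans x≈z (R.sym y≈z)))
          , R.trans (R.*-congˡ (R.sym y≈z)) xy≈0)
      , (λ x≈z (x≉y , xy≈0) →
          (λ z≈y → x≉y (R.trans x≈z z≈y))
          , R.trans (R.*-congʳ (R.sym x≈z)) xy≈0)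
    ; ~-sym  = λ {(x , _)} {(y , _)} (x≉y , xy≈0) →
        (λ y≈x → x≉y (R.sym y≈x)) , R.trans (R.*-comm y x) xy≈0
    ; irrefl = λ x≈y (x≉y , _) → x≉y x≈y
    }

-- Residue classes modulo n are integers up to congruence, so n = 0 needs no
-- special treatment.
infix 4 _≡_[mod_]
_≡_[mod_] : ℤ → ℤ → ℕ → Set
x ≡ y [mod n ] = + n ∣ (x ℤ.- y)

module _ (n : ℕ) where
  private
    _≋_ : Rel ℤ 0ℓ
    x ≋ y = x ≡ y [mod n ]

    open ℤ-Solver.+-*-Solver

    ≋-reflexive : ∀ {x y} → x ≡ y → x ≋ y
    ≋-reflexive {x} refl =
      subst (+ n ∣_) (sym (ℤ.+-inverseʳ x)) (ℤ∣.divides (+ 0) refl)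

    ≋-sym : Symmetric _≋_
    ≋-sym {x} {y} p = subst (+ n ∣_) (lem x y) (ℤ∣.∣m⇒∣-m p)
      where
      lem : ∀ x y → ℤ.- (x ℤ.- y) ≡ y ℤ.- x
      lem = solve 2 (λ x y → :- (x :- y) := y :- x) refl

    ≋-trans : ∀ {x y z} → x ≋ y → y ≋ z → x ≋ z
    ≋-trans {x} {y} {z} p q = subst (+ n ∣_) (lem x y z) (ℤ∣.∣m∣n⇒∣m+n p q)
      where
      lem : ∀ x y z → (x ℤ.- y) ℤ.+ (y ℤ.- z) ≡ x ℤ.- z
      lem = solve 3 (λ x y z → (x :- y) :+ (y :- z) := x :- z) refl

    +-cong : Congruent₂ _≋_ ℤ._+_
    +-cong {x} {y} {u} {v} p q = subst (+ n ∣_) (lem x y u v) (ℤ∣.∣m∣n⇒∣m+n p q)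
      where
      lem : ∀ x y u v → (x ℤ.- y) ℤ.+ (u ℤ.- v) ≡ (x ℤ.+ u) ℤ.- (y ℤ.+ v)
      lem = solve 4 (λ x y u v → (x :- y) :+ (u :- v) := (x :+ u) :- (y :+ v)) refl

    *-cong : Congruent₂ _≋_ ℤ._*_
    *-cong {x} {y} {u} {v} p q =
      subst (+ n ∣_) (lem x y u v)
        (ℤ∣.∣m∣n⇒∣m+n (ℤ∣.∣n⇒∣m*n u p) (ℤ∣.∣n⇒∣m*n y q))
      where
      lem : ∀ x y u v → u ℤ.* (x ℤ.- y) ℤ.+ y ℤ.* (u ℤ.- v) ≡ (x ℤ.* u) ℤ.- (y ℤ.* v)
      lem = solve 4 (λ x y u v →
        u :* (x :- y) :+ y :* (u :- v) := (x :* u) :- (y :* v)) refl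

    neg-cong : Congruent₁ _≋_ (ℤ.-_)
    neg-cong {x} {y} p = subst (+ n ∣_) (lem x y) (ℤ∣.∣m⇒∣-m p)
      where
      lem : ∀ x y → ℤ.- (x ℤ.- y) ≡ (ℤ.- x) ℤ.- (ℤ.- y)
      lem = solve 2 (λ x y → :- (x :- y) := (:- x) :- (:- y)) refl

  ℤ/ : CommutativeRing 0ℓ 0ℓ
  ℤ/ = record
    { Carrier = ℤ
    ; _≈_ = λ x y → x ≡ y [mod n ]
    ; _+_ = ℤ._+_
    ; _*_ = ℤ._*_
    ; -_  = ℤ.-_
    ; 0#  = + 0
    ; 1#  = + 1
    ; isCommutativeRing = record
      { isRing = record
        { +-isAbelianGroup = record
          { isGroup = record
            { isMonoid = record
              { isSemigroup = record
                { isMagma = record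
                  { isEquivalence = record
                    { refl  = λ {x} → ≋-reflexive {x} refl
                    ; sym   = λ {x} {y} → ≋-sym {x} {y}
                    ; trans = λ {x} {y} {z} → ≋-trans {x} {y} {z}
                    }
                  ; ∙-cong = λ {x} {y} {u} {v} → +-cong {x} {y} {u} {v}
                  }
                ; assoc = λ x y z → ≋-reflexive (ℤ.+-assoc x y z)
                }
              ; identity = (λ x → ≋-reflexive (ℤ.+-identityˡ x))
                         , (λ x → ≋-reflexive (ℤ.+-identityʳ x))
              }
            ; inverse = (λ x → ≋-reflexive (ℤ.+-inverseˡ x))
                      , (λ x → ≋-reflexive (ℤ.+-inverseʳ x))
            ; ⁻¹-cong = λ {x} {y} → neg-cong {x} {y}
            }
          ; comm = λ x y → ≋-reflexive (ℤ.+-comm x y)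
          }
        ; *-cong = λ {x} {y} {u} {v} → *-cong {x} {y} {u} {v}
        ; *-assoc = λ x y z → ≋-reflexive (ℤ.*-assoc x y z)
        ; *-identity = (λ x → ≋-reflexive (ℤ.*-identityˡ x))
                     , (λ x → ≋-reflexive (ℤ.*-identityʳ x))
        ; distrib = (λ x y z → ≋-reflexive (ℤ.*-distribˡ-+ x y z))
                  , (λ x y z → ≋-reflexive (ℤ.*-distribʳ-+ x y z))
        }
      ; *-comm = λ x y → ≋-reflexive (ℤ.*-comm x y)
      }
    }

  ℤ/-≟ : Decidable (CommutativeRing._≈_ ℤ/)
  ℤ/-≟ x y = + n ℤ∣.∣? (x ℤ.- y)

Γ : ℕ → Graph
Γ n = zeroDivisorGraph (ℤ/ n) (ℤ/-≟ n)

{-# OPTIONS --safe #-}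
module Submission where

-- Modulo 2q the zero divisors are q and the nonzero even residues, and the only
-- products that vanish are those of q with an even residue: the graph is a star with
-- centre q and q - 1 leaves, and its line graph is complete on q - 1 vertices. The
-- characteristic polynomial of a complete graph on n + 1 vertices is
-- (x - n) (x + 1)^n, so the energy is 2n, here with n = q - 2.

open import Defs
open import Algebra.Bundles using (RawRing; CommutativeRing; Semiring)
import Algebra.Definitions.RawSemiring as RawSemiringOps
import Algebra.Properties.Monoid.Sum as MonoidSum
import Algebra.Properties.Ring as RingProperties
import Algebra.Properties.Semiring.Mult as SemiringMult
import Algebra.Solver.Ring.NaturalCoefficients.Default as SemiringSolver
open import Data.Bool.Base using (true; false; not; if_then_else_)
open import Data.Fin.Base using (Fin; zero; suc; toℕ; fromℕ<; punchIn)
import Data.Fin.Properties as Fin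
open import Data.Nat.Base using (ℕ; zero; suc)
open import Data.Vec.Functional using (Vector; replicate)
open import Function.Base using (_∘_)
import Relation.Binary.Reasoning.Setoid as SetoidReasoning
open import Relation.Nullary using (¬_; does; yes; no; contradiction)

-- Determinants over a commutative ring.

module Determinants {ℓ₁ ℓ₂} (R : CommutativeRing ℓ₁ ℓ₂) where
  open CommutativeRing R hiding (zero)
  open MatrixOps rawRing using () renaming (Matrix to Matrixᴿ; minor to minorᴿ; det to detᴿ)
  open RawSemiringOps (Semiring.rawSemiring semiring) using (_^_)
  open MonoidSum +-monoid using (sum-cong-≋; sum-replicate; sum-replicate-zero)
    renaming (sum to ∑)
  open MonoidSum *-monoid using () renaming (sum to ∏; sum-replicate to ∏-replicate)
  open RingProperties ring using (-1*x≈-x)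
  open SemiringMult semiring using (_×_; ×-congʳ; ×-assoc-*; ×-comm-*)
  open SemiringSolver commutativeSemiring
  open SetoidReasoning setoid

  sign : ∀ {n} → Fin n → Carrier
  sign j = (- 1#) ^ toℕ j

  -- The solver knows only the semiring structure: it treats - 1# as a variable m,
  -- and the identity 1 + m ≈ 0 is applied afterwards.
  private
    cancel : ∀ {x w} y → x ≈ y + (1# + - 1#) * w → x ≈ y
    cancel {x} {w} y x≈ = begin
      x                   ≈⟨ x≈ ⟩
      y + (1# + - 1#) * w ≈⟨ +-congˡ (*-congʳ (-‿inverseʳ 1#)) ⟩
      y + 0# * w          ≈⟨ +-congˡ (zeroˡ w) ⟩
      y + 0#              ≈⟨ +-identityʳ y ⟩
      y                   ∎

    sign-square : ∀ {n} (j : Fin n) → sign j * sign j ≈ 1#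
    sign-square zero    = *-identityˡ 1#
    sign-square (suc j) = trans (lem (- 1#) (sign j)) (trans (*-cong m² (sign-square j)) (*-identityˡ 1#))
      where
      lem : ∀ m s → m * s * (m * s) ≈ m * m * (s * s)
      lem = solve 2 (λ m s → m :* s :* (m :* s) := m :* m :* (s :* s)) refl
      lem′ : ∀ m → m * m + (1# + m) ≈ 1# + (1# + m) * m
      lem′ = solve 1 (λ m → m :* m :+ (con 1 :+ m) := con 1 :+ (con 1 :+ m) :* m) refl
      -- To reach the form that `cancel` expects without subtracting, the vanishing term `1# + m` is
      -- first added on the left.
      m² : - 1# * - 1# ≈ 1#
      m² = begin
        - 1# * - 1#                ≈⟨ +-identityʳ _ ⟨
        - 1# * - 1# + 0#           ≈⟨ +-congˡ (-‿inverseʳ 1#) ⟨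
        - 1# * - 1# + (1# + - 1#)  ≈⟨ cancel 1# (lem′ (- 1#)) ⟩
        1#                         ∎

    sum-zero : ∀ {n} {v : Vector Carrier n} → (∀ i → v i ≈ 0#) → ∑ v ≈ 0#
    sum-zero {n} v≈0 = trans (sum-cong-≋ v≈0) (sum-replicate-zero n)

    vanishing-term : ∀ s x {d} → d ≈ 0# → s * (x * d) ≈ 0#
    vanishing-term s x d≈0 = trans (*-congˡ (trans (*-congˡ d≈0) (zeroʳ x))) (zeroʳ s)

  det-cong : ∀ {n} {M N : Matrixᴿ n} → (∀ i j → M i j ≈ N i j) → detᴿ M ≈ detᴿ N
  det-cong {zero}  M≋N = refl
  det-cong {suc n} M≋N = sum-cong-≋ λ j →
    *-congˡ {sign j} (*-cong (M≋N zero j) (det-cong λ i k → M≋N (suc i) (punchIn j k)))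

  -- The first two terms of the expansion cancel; the other minors again have
  -- equal first columns.
  det-equal-columns : ∀ {n} (M : Matrixᴿ (suc (suc n))) →
    (∀ i → M i zero ≈ M i (suc zero)) → detᴿ M ≈ 0#
  det-equal-columns {n} M M₀≋M₁ = begin
    detᴿ M
      ≈⟨ +-congˡ (+-cong (*-congˡ (*-cong (sym (M₀≋M₁ zero)) (det-cong same-minor)))
           (sum-zero λ l → vanishing-term (sign (suc (suc l))) (M zero (suc (suc l))) (minor-vanishes M M₀≋M₁ l))) ⟩
    1# * t + (- 1# * 1# * t + 0#)
      ≈⟨ cancel 0# (lem (- 1#) t) ⟩
    0# ∎
    where
    t : Carrier
    t = M zero zero * detᴿ (minorᴿ M zero)

    lem : ∀ m t → 1# * t + (m * 1# * t + 0#) ≈ 0# + (1# + m) * t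
    lem = solve 2 (λ m t → con 1 :* t :+ (m :* con 1 :* t :+ con 0) := con 0 :+ (con 1 :+ m) :* t) refl

    same-minor : ∀ i k → minorᴿ M (suc zero) i k ≈ minorᴿ M zero i k
    same-minor i zero    = M₀≋M₁ (suc i)
    same-minor i (suc k) = refl

    minor-vanishes : ∀ {n} (M : Matrixᴿ (suc (suc n))) → (∀ i → M i zero ≈ M i (suc zero)) →
      ∀ l → detᴿ (minorᴿ M (suc (suc l))) ≈ 0#
    minor-vanishes {suc n} M M₀≋M₁ l = det-equal-columns (minorᴿ M (suc (suc l))) (M₀≋M₁ ∘ suc)

  module _ (c b : Carrier) where

    -- c I + b J, where J is the all-ones matrix.
    cI+bJ : ∀ {n} → Matrixᴿ n
    cI+bJ i j = if does (i Fin.≟ j) then c + b else b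

    -- c I + b J with column j removed and a constant column b put in front: up to
    -- vanishing ones, these are the minors met when expanding det cI+bJ.
    bordered : ∀ {n} → Fin (suc n) → Matrixᴿ (suc n)
    bordered j i zero    = b
    bordered j i (suc k) = cI+bJ i (punchIn j k)

    -- Proved by mutual induction with `det-bordered`, expanding along the first row. The diagonal
    -- term contributes `c + b` times the smaller determinant; all other minors are bordered
    -- matrices.
    det-cI+bJ : ∀ n → detᴿ (cI+bJ {suc n}) ≈ c ^ n * (c + suc n × b)
    -- Source of the formula: moving the constant column to position `j` costs `sign j`, and
    -- subtracting it from the other columns leaves only `c` on their diagonals.
    det-bordered : ∀ {n} (j : Fin (suc n)) → detᴿ (bordered j) ≈ sign j * (b * c ^ n)

    private
      -- The sign of the expansion meets the sign in `det-bordered`. Their product is `- 1#` for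
      -- every `j`, so the summands are all equal. This handles the tail of any first row that is
      -- `b` after its first entry.
      bordered-expansion : ∀ n {d : Fin (suc n) → Carrier} → (∀ j → d j ≈ detᴿ (bordered j)) →
        ∑ (λ j → sign (suc j) * (b * d j)) ≈ (suc n × b) * (- 1# * (b * c ^ n))
      bordered-expansion n {d} d≈ = begin
        ∑ (λ j → sign (suc j) * (b * d j))
          ≈⟨ sum-cong-≋ summand ⟩
        ∑ (replicate (suc n) (b * (- 1# * (b * c ^ n))))
          ≈⟨ sum-replicate (suc n) ⟩
        suc n × (b * (- 1# * (b * c ^ n)))
          ≈⟨ ×-assoc-* (suc n) b _ ⟨
        (suc n × b) * (- 1# * (b * c ^ n)) ∎
        where
        lem : ∀ m s b x → m * s * (b * (s * x)) ≈ s * s * (b * (m * x))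
        lem = solve 4 (λ m s b x → m :* s :* (b :* (s :* x)) := s :* s :* (b :* (m :* x))) refl
        summand : ∀ j → sign (suc j) * (b * d j) ≈ b * (- 1# * (b * c ^ n))
        summand j = begin
          - 1# * sign j * (b * d j)
            ≈⟨ *-congˡ (*-congˡ (trans (d≈ j) (det-bordered j))) ⟩
          - 1# * sign j * (b * (sign j * (b * c ^ n)))
            ≈⟨ lem (- 1#) (sign j) b (b * c ^ n) ⟩
          sign j * sign j * (b * (- 1# * (b * c ^ n)))
            ≈⟨ *-congʳ (sign-square j) ⟩
          1# * (b * (- 1# * (b * c ^ n)))
            ≈⟨ *-identityˡ _ ⟩
          b * (- 1# * (b * c ^ n)) ∎

      minor-cI+bJ : ∀ {n} (j : Fin (suc n)) i k →
        minorᴿ (cI+bJ {suc (suc n)}) (suc j) i k ≈ bordered j i k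
      minor-cI+bJ j i zero    = refl
      minor-cI+bJ j i (suc k) = refl

      minor-bordered-zero : ∀ {n} (j : Fin (suc n)) i k →
        minorᴿ (bordered (zero {suc n})) (suc j) i k ≈ bordered j i k
      minor-bordered-zero j i zero    = refl
      minor-bordered-zero j i (suc k) = refl

      -- Below the first row, columns 0 and 1 of `bordered (suc j)` are both constantly `b`: the
      -- second is column 0 of `cI+bJ`, which survives the removal of column `suc j`. Deleting
      -- either one therefore leaves the same matrix.
      minor-bordered-suc₀ : ∀ {n} (j : Fin (suc n)) i k →
        minorᴿ (bordered (suc j)) zero i k ≈ bordered j i k
      minor-bordered-suc₀ j i zero    = refl
      minor-bordered-suc₀ j i (suc k) = refl

      minor-bordered-suc₁ : ∀ {n} (j : Fin (suc n)) i k →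
        minorᴿ (bordered (suc j)) (suc zero) i k ≈ bordered j i k
      minor-bordered-suc₁ j i zero    = refl
      minor-bordered-suc₁ j i (suc k) = refl

      minor-bordered-vanishes : ∀ {n} (j : Fin (suc n)) l →
        detᴿ (minorᴿ (bordered (suc j)) (suc (suc l))) ≈ 0#
      minor-bordered-vanishes {suc n} j l =
        det-equal-columns (minorᴿ (bordered (suc j)) (suc (suc l))) (λ _ → refl)

    det-cI+bJ zero = lem c b
      where
      lem : ∀ c b → 1# * ((c + b) * 1#) + 0# ≈ 1# * (c + (b + 0#))
      lem = solve 2 (λ c b → con 1 :* ((c :+ b) :* con 1) :+ con 0 := con 1 :* (c :+ (b :+ con 0))) refl
    det-cI+bJ (suc n) = begin
      detᴿ (cI+bJ {suc (suc n)})
        ≈⟨ +-cong (*-congˡ (*-congˡ (det-cI+bJ n)))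
                  (bordered-expansion n λ j → det-cong (minor-cI+bJ j)) ⟩
      1# * ((c + b) * (c ^ n * (c + u))) + u * (- 1# * (b * c ^ n))
        ≈⟨ cancel (c ^ suc n * (c + (b + u))) (lem (- 1#) c b (c ^ n) u) ⟩
      c ^ suc n * (c + suc (suc n) × b) ∎
      where
      u : Carrier
      u = suc n × b
      lem : ∀ m c b C u → 1# * ((c + b) * (C * (c + u))) + u * (m * (b * C))
        ≈ c * C * (c + (b + u)) + (1# + m) * (u * (b * C))
      lem = solve 5 (λ m c b C u → con 1 :* ((c :+ b) :* (C :* (c :+ u))) :+ u :* (m :* (b :* C))
        := c :* C :* (c :+ (b :+ u)) :+ (con 1 :+ m) :* (u :* (b :* C))) refl

    det-bordered {zero} zero = lem b
      where
      lem : ∀ b → 1# * (b * 1#) + 0# ≈ 1# * (b * 1#)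
      lem = solve 1 (λ b → con 1 :* (b :* con 1) :+ con 0 := con 1 :* (b :* con 1)) refl
    det-bordered {suc n} zero = begin
      detᴿ (bordered (zero {suc n}))
        ≈⟨ +-cong (*-congˡ (*-congˡ (det-cI+bJ n)))
                  (bordered-expansion n λ j → det-cong (minor-bordered-zero j)) ⟩
      1# * (b * (c ^ n * (c + u))) + u * (- 1# * (b * c ^ n))
        ≈⟨ cancel (1# * (b * c ^ suc n)) (lem (- 1#) c b (c ^ n) u) ⟩
      1# * (b * c ^ suc n) ∎
      where
      u : Carrier
      u = suc n × b
      lem : ∀ m c b C u → 1# * (b * (C * (c + u))) + u * (m * (b * C))
        ≈ 1# * (b * (c * C)) + (1# + m) * (u * (b * C))
      lem = solve 5 (λ m c b C u → con 1 :* (b :* (C :* (c :+ u))) :+ u :* (m :* (b :* C))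
        := con 1 :* (b :* (c :* C)) :+ (con 1 :+ m) :* (u :* (b :* C))) refl
    -- The first row starts with `b`, `c + b`, and these two entries have the same minor, of
    -- determinant `e`: together they give `- c` times `e`. Every later minor keeps two equal
    -- columns and vanishes.
    det-bordered {suc n} (suc j) = begin
      detᴿ (bordered (suc j))
        ≈⟨ +-cong (*-congˡ (*-congˡ (trans (det-cong (minor-bordered-suc₀ j)) (det-bordered j))))
            (+-cong (*-congˡ (*-congˡ (trans (det-cong (minor-bordered-suc₁ j)) (det-bordered j))))
              (sum-zero λ l → vanishing-term (sign (suc (suc l))) (bordered (suc j) zero (suc (suc l)))
                (minor-bordered-vanishes j l))) ⟩
      1# * (b * e) + (- 1# * 1# * ((c + b) * e) + 0#)
        ≈⟨ cancel (sign (suc j) * (b * c ^ suc n)) (lem (- 1#) c b (sign j) (c ^ n)) ⟩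
      sign (suc j) * (b * c ^ suc n) ∎
      where
      e : Carrier
      e = sign j * (b * c ^ n)
      lem : ∀ m c b s C →
        1# * (b * (s * (b * C))) + (m * 1# * ((c + b) * (s * (b * C))) + 0#)
          ≈ m * s * (b * (c * C)) + (1# + m) * (b * (s * (b * C)))
      lem = solve 5 (λ m c b s C →
        con 1 :* (b :* (s :* (b :* C))) :+ (m :* con 1 :* ((c :+ b) :* (s :* (b :* C))) :+ con 0)
          := m :* s :* (b :* (c :* C)) :+ (con 1 :+ m) :* (b :* (s :* (b :* C)))) refl

  -- The constant vector has eigenvalue `n`; vectors of coordinate sum zero have eigenvalue `- 1#`.
  complete-eigenvalues : ∀ {n} → Vector Carrier (suc n)
  complete-eigenvalues {n} zero    = n × 1#
  complete-eigenvalues     (suc _) = - 1#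

  -- The matrix is `(x + 1) I - J`, so `det-cI+bJ` applies with `b` equal to `- 1#`, and its last
  -- factor becomes `x - n`.
  det-complete : ∀ n x (M : Matrixᴿ (suc n)) →
    (∀ i j → M i j ≈ (if does (i Fin.≟ j) then x else - 1#)) →
    detᴿ M ≈ ∏ (λ i → x - complete-eigenvalues {n} i)
  det-complete n x M M≋ = begin
    detᴿ M
      ≈⟨ det-cong (λ i j → trans (M≋ i j) (entry i j)) ⟩
    detᴿ (cI+bJ c (- 1#) {suc n})
      ≈⟨ det-cI+bJ c (- 1#) n ⟩
    c ^ n * (c + suc n × - 1#)
      ≈⟨ *-congˡ factor ⟩
    c ^ n * (x - n × 1#)
      ≈⟨ *-comm _ _ ⟩
    (x - n × 1#) * c ^ n
      ≈⟨ *-congˡ (∏-replicate n) ⟨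
    ∏ (λ i → x - complete-eigenvalues {n} i) ∎
    where
    c : Carrier
    -- In this form `c` is literally the factor contributed by each eigenvalue `- 1#`, so
    -- `∏-replicate` applies directly.
    c = x - - 1#

    c-1≈x : c + - 1# ≈ x
    c-1≈x = begin
      x + - - 1# + - 1#    ≈⟨ +-assoc x (- - 1#) (- 1#) ⟩
      x + (- - 1# + - 1#)  ≈⟨ +-congˡ (-‿inverseˡ (- 1#)) ⟩
      x + 0#               ≈⟨ +-identityʳ x ⟩
      x                    ∎

    entry : ∀ (i j : Fin (suc n)) → (if does (i Fin.≟ j) then x else - 1#) ≈ cI+bJ c (- 1#) i j
    entry i j with does (i Fin.≟ j)
    ... | true  = sym c-1≈x
    ... | false = refl

    factor : c + suc n × - 1# ≈ x - n × 1#
    factor = begin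
      c + (- 1# + n × - 1#)    ≈⟨ +-assoc c (- 1#) (n × - 1#) ⟨
      c + - 1# + n × - 1#      ≈⟨ +-cong c-1≈x (×-congʳ n (sym (*-identityʳ (- 1#)))) ⟩
      x + n × (- 1# * 1#)      ≈⟨ +-congˡ (×-comm-* n (- 1#) 1#) ⟨
      x + - 1# * (n × 1#)      ≈⟨ +-congˡ (-1*x≈-x (n × 1#)) ⟩
      x - n × 1#               ∎

-- Determinants and products under maps compatible with the ring operations.

module _ {ℓ₁ ℓ₂ ℓ₃ ℓ₄} (A : RawRing ℓ₁ ℓ₂) (R : CommutativeRing ℓ₃ ℓ₄) where
  private
    module A = RawRing A
  open CommutativeRing R hiding (zero)

  -- φ need not respect the equality of A: for a real x, the k-th term of the
  -- sequence x depends on its representative.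
  module Homomorphism
    (φ : A.Carrier → Carrier)
    (φ-+ : ∀ x y → φ (x A.+ y) ≈ φ x + φ y)
    (φ-* : ∀ x y → φ (x A.* y) ≈ φ x * φ y)
    (φ-neg : ∀ x → φ (A.- x) ≈ - φ x)
    (φ-0# : φ A.0# ≈ 0#)
    (φ-1# : φ A.1# ≈ 1#)
    where

    private
      module Aᴹ = MatrixOps A
      module Rᴹ = MatrixOps rawRing
      module A^ = RawSemiringOps A.rawSemiring
      module R^ = RawSemiringOps (Semiring.rawSemiring semiring)

    φ-sum : ∀ {n} (v : Vector A.Carrier n) → φ (Aᴹ.sum v) ≈ Rᴹ.sum (φ ∘ v)
    φ-sum {zero}  v = φ-0#
    φ-sum {suc n} v = trans (φ-+ _ _) (+-congˡ (φ-sum (v ∘ suc)))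

    φ-product : ∀ {n} (v : Vector A.Carrier n) → φ (Aᴹ.product v) ≈ Rᴹ.product (φ ∘ v)
    φ-product {zero}  v = φ-1#
    φ-product {suc n} v = trans (φ-* _ _) (*-congˡ (φ-product (v ∘ suc)))

    φ-sign : ∀ n → φ ((A.- A.1#) A^.^ n) ≈ (- 1#) R^.^ n
    φ-sign zero    = φ-1#
    φ-sign (suc n) = trans (φ-* _ _) (*-cong (trans (φ-neg A.1#) (-‿cong φ-1#)) (φ-sign n))

    φ-det : ∀ {n} (M : Aᴹ.Matrix n) → φ (Aᴹ.det M) ≈ Rᴹ.det (λ i j → φ (M i j))
    φ-det {zero}  M = φ-1#
    φ-det {suc n} M = trans
      (φ-sum (λ j → (A.- A.1#) A^.^ toℕ j A.* (M zero j A.* Aᴹ.det (Aᴹ.minor M j))))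
      (MonoidSum.sum-cong-≋ +-monoid λ j → trans (φ-* _ _) (*-cong (φ-sign (toℕ j))
        (trans (φ-* (M zero j) _) (*-congˡ (φ-det (Aᴹ.minor M j))))))

open import Data.Integer.Base using (+_; _-_) renaming (_*_ to _*ℤ_)
import Data.Integer.Base as ℤ
import Data.Integer.Divisibility.Signed as ℤ∣
import Data.Integer.DivMod as ℤ
import Data.Integer.Properties as ℤ
import Data.Integer.Solver as ℤ-Solver
open import Data.Nat.Base using (_*_)
import Data.Nat.Base as ℕ
import Data.Nat.Divisibility as ℕ∣
open import Data.Nat.Divisibility using (_∣_)
open import Data.Nat.Primality
  using (Prime; prime[2]; ¬prime[0]; ¬prime[1]; prime⇒nonZero; euclidsLemma)
import Data.Nat.Properties as ℕ
open import Data.Product.Base using (∃-syntax; _,_)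
open import Data.Rational.Base as ℚ using (ℚ; 0ℚ; 1ℚ)
import Data.Rational.Properties as ℚ
import Data.Rational.Unnormalised.Base as ℚᵘ
import Data.Rational.Unnormalised.Properties as ℚᵘ
open import Data.Sum.Base as Sum using (_⊎_; inj₁; inj₂)
open import Function.Bundles using (Inverse)
open import Function.Properties.Bijection using (Bijection⇒Inverse)
open import Relation.Binary.Bundles using (DecSetoid)
open import Relation.Binary.PropositionalEquality
open import Relation.Nullary.Decidable using (dec-true; dec-false)

-- The energy of a complete graph.

private
  module ℚᴹ = MatrixOps (CommutativeRing.rawRing ℚ.+-*-commutativeRing)

open Determinants ℚ.+-*-commutativeRing using (det-complete; complete-eigenvalues)
open SemiringMult (CommutativeRing.semiring ℚ.+-*-commutativeRing) using (_×_; ×-homo-+)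
open MonoidSum ℚ.+-0-monoid using (sum-replicate)
open ≡-Reasoning

-- Real arithmetic is termwise, so every compatibility is `refl`. An identity between real
-- determinants reduces, index by index, to one over `ℚ`, where equality is `≡`.
module Seq (k : ℕ) = Homomorphism ℝ-rawRing ℚ.+-*-commutativeRing (λ x → seq x k)
  (λ _ _ → refl) (λ _ _ → refl) (λ _ → refl) refl refl

≗⇒≈ℝ : ∀ x y → (∀ k → seq x k ≡ seq y k) → x ≈ℝ y
≗⇒≈ℝ x y x≗y ε 0<ε = 0 , λ k _ →
  subst (λ p → ℚ.∣ p ∣ ℚ.< ε)
    (sym (trans (cong (ℚ._- seq y k) (x≗y k)) (ℚ.+-inverseʳ (seq y k)))) 0<ε

×1≡/1 : ∀ n → n × 1ℚ ≡ + n ℚ./ 1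
×1≡/1 zero    = refl
×1≡/1 (suc n) = begin
  1ℚ ℚ.+ n × 1ℚ       ≡⟨ cong (1ℚ ℚ.+_) (×1≡/1 n) ⟩
  1ℚ ℚ.+ + n ℚ./ 1    ≡⟨ ℚ.toℚᵘ-injective homo ⟩
  + suc n ℚ./ 1       ∎
  where
  -- Passing to unnormalised fractions avoids reduction by the gcd; only a cross-multiplication
  -- remains.
  homo : ℚ.toℚᵘ (1ℚ ℚ.+ + n ℚ./ 1) ℚᵘ.≃ ℚ.toℚᵘ (+ suc n ℚ./ 1)
  homo = ℚᵘ.≃-trans (ℚ.toℚᵘ-homo-+ 1ℚ (+ n ℚ./ 1))
    (ℚᵘ.≃-trans (ℚᵘ.+-congʳ ℚᵘ.1ℚᵘ (ℚ.toℚᵘ-fromℚᵘ (ℚᵘ.mkℚᵘ (+ n) 0)))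
    (ℚᵘ.≃-trans (ℚᵘ.*≡* (cong (ℤ._* + 1) (cong (λ i → + 1 ℤ.+ i) (ℤ.*-identityʳ (+ n)))))
    (ℚᵘ.≃-sym (ℚ.toℚᵘ-fromℚᵘ (ℚᵘ.mkℚᵘ (+ suc n) 0)))))

∣n×1∣≡n×1 : ∀ n → ℚ.∣ n × 1ℚ ∣ ≡ n × 1ℚ
∣n×1∣≡n×1 n = begin
  ℚ.∣ n × 1ℚ ∣      ≡⟨ cong ℚ.∣_∣ (×1≡/1 n) ⟩
  ℚ.∣ + n ℚ./ 1 ∣   ≡⟨ ℚ.0≤p⇒∣p∣≡p (ℚ.nonNegative⁻¹ (+ n ℚ./ 1) {{ℚ.normalize-nonNeg n 1}}) ⟩
  + n ℚ./ 1         ≡⟨ ×1≡/1 n ⟨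
  n × 1ℚ            ∎

complete-energy : ∀ G {n} (enum : Enumeration G (suc n)) →
  (∀ {i j} → i ≢ j → Graph._~_ G (Inverse.to enum i) (Inverse.to enum j)) →
  HasEnergy G (fromℤ (+ (n ℕ.+ n)))
complete-energy G {n} enum adj =
  suc n , enum , ev , eigenvalues , ≗⇒≈ℝ (sum (λ i → ∣ ev i ∣ℝ)) (fromℤ (+ (n ℕ.+ n))) energy
  where
  open Graph G
  open Inverse enum using (to)
  ev : Vector ℝ (suc n)
  ev i = fromℚ (complete-eigenvalues i)

  adjacent : ∀ i j → does (to i ~? to j) ≡ not (does (i Fin.≟ j))
  adjacent i j with i Fin.≟ j
  ... | yes refl = dec-false (to i ~? to i) (irrefl (DecSetoid.refl vertices))
  ... | no  i≢j  = dec-true (to i ~? to j) (adj i≢j)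

  entry : ∀ x k i j → seq (charMatrix (adjacencyMatrix G enum) x i j) k
            ≡ (if does (i Fin.≟ j) then seq x k else ℚ.- 1ℚ)
  -- Once `adjacent` replaces the adjacency test, the entries of the identity and of the adjacency
  -- matrix depend on the same Boolean, and a case split on it suffices.
  entry x k i j = trans
    (cong (λ b → seq (x *ℝ identity i j +ℝ -ℝ (if b then 1ℝ else 0ℝ)) k) (adjacent i j))
    (charEntry (does (i Fin.≟ j)))
    where
    charEntry : ∀ b → seq (x *ℝ (if b then 1ℝ else 0ℝ) +ℝ -ℝ (if not b then 1ℝ else 0ℝ)) k
                      ≡ (if b then seq x k else ℚ.- 1ℚ)
    charEntry true  = trans (ℚ.+-identityʳ (seq x k ℚ.* 1ℚ)) (ℚ.*-identityʳ (seq x k))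
    charEntry false = trans (cong (ℚ._+ (ℚ.- 1ℚ)) (ℚ.*-zeroʳ (seq x k))) (ℚ.+-identityˡ (ℚ.- 1ℚ))

  spectrum : ∀ x k → seq (det (charMatrix (adjacencyMatrix G enum) x)) k ≡ seq (product (λ i → x -ℝ ev i)) k
  spectrum x k = trans
    (Seq.φ-det k (charMatrix (adjacencyMatrix G enum) x))
    (trans (det-complete n (seq x k) (λ i j → seq (charMatrix (adjacencyMatrix G enum) x i j) k) (entry x k))
      (sym (Seq.φ-product k (λ i → x -ℝ ev i))))

  eigenvalues : AreEigenvalues (adjacencyMatrix G enum) ev
  eigenvalues x = ≗⇒≈ℝ (det (charMatrix (adjacencyMatrix G enum) x)) (product (λ i → x -ℝ ev i)) (spectrum x)

  energy : ∀ k → seq (sum (λ i → ∣ ev i ∣ℝ)) k ≡ + (n ℕ.+ n) ℚ./ 1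
  energy k = begin
    seq (sum (λ i → ∣ ev i ∣ℝ)) k
      ≡⟨ Seq.φ-sum k (λ i → ∣ ev i ∣ℝ) ⟩
    ℚ.∣ n × 1ℚ ∣ ℚ.+ ℚᴹ.sum (replicate n 1ℚ)
      ≡⟨ cong₂ ℚ._+_ (∣n×1∣≡n×1 n) (sum-replicate n) ⟩
    n × 1ℚ ℚ.+ n × 1ℚ
      ≡⟨ ×-homo-+ 1ℚ n n ⟨
    (n ℕ.+ n) × 1ℚ
      ≡⟨ ×1≡/1 (n ℕ.+ n) ⟩
    + (n ℕ.+ n) ℚ./ 1 ∎

-- Divisibility of integers.

∣-small⇒≡0 : ∀ {q n} → q ∣ n → n ℕ.< q → n ≡ 0
∣-small⇒≡0 {n = zero}  _   _   = refl
∣-small⇒≡0 {n = suc n} q∣n n<q = contradiction q∣n (ℕ∣.>⇒∤ n<q)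

-- The absolute difference is at most the maximum of `a` and `b`, hence below `q`, and the only such
-- multiple of `q` is 0.
∣-difference⇒≡ : ∀ {q a b} → a ℕ.< q → b ℕ.< q → + q ℤ∣.∣ + a - + b → a ≡ b
∣-difference⇒≡ {q} {a} {b} a<q b<q q∣a-b =
  ℤ.+-injective (ℤ.i-j≡0⇒i≡j (+ a) (+ b) (ℤ.∣i∣≡0⇒i≡0 (∣-small⇒≡0 (ℤ∣.∣⇒∣ᵤ q∣a-b) small)))
  where
  small : ℤ.∣ + a - + b ∣ ℕ.< q
  small rewrite ℤ.[+m]-[+n]≡m⊖n a b = ℕ.≤-<-trans (ℤ.∣m⊝n∣≤m⊔n a b) (ℕ.⊔-pres-<m a<q b<q)

odd⇒1+even : ∀ x → ¬ (+ 2 ℤ∣.∣ x) → ∃[ k ] x ≡ + 1 ℤ.+ k *ℤ + 2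
odd⇒1+even x 2∤x with x ℤ.%ℕ 2 | ℤ.n%ℕd<d x 2 | ℤ.a≡a%ℕn+[a/ℕn]*n x 2
... | 0           | _ | x≡ = contradiction (ℤ∣.divides (x ℤ./ℕ 2) (trans x≡ (ℤ.+-identityˡ _))) 2∤x
... | 1           | _ | x≡ = x ℤ./ℕ 2 , x≡
... | suc (suc _) | ℕ.s≤s (ℕ.s≤s ()) | _

odd-odd⇒even : ∀ x y → ¬ (+ 2 ℤ∣.∣ x) → ¬ (+ 2 ℤ∣.∣ y) → + 2 ℤ∣.∣ x - y
odd-odd⇒even x y 2∤x 2∤y with odd⇒1+even x 2∤x | odd⇒1+even y 2∤y
... | k , refl | l , refl = ℤ∣.divides (k - l) (lem k l)
  where
  open ℤ-Solver.+-*-Solver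
  lem : ∀ k l → (+ 1 ℤ.+ k *ℤ + 2) - (+ 1 ℤ.+ l *ℤ + 2) ≡ (k - l) *ℤ + 2
  lem = solve 2 (λ k l → (con (+ 1) :+ k :* con (+ 2)) :- (con (+ 1) :+ l :* con (+ 2))
                         := (k :- l) :* con (+ 2)) refl

euclidsLemmaℤ : ∀ {p} → Prime p → ∀ x y → + p ℤ∣.∣ x *ℤ y → + p ℤ∣.∣ x ⊎ + p ℤ∣.∣ y
euclidsLemmaℤ {p} p-prime x y p∣xy = Sum.map ℤ∣.∣ᵤ⇒∣ ℤ∣.∣ᵤ⇒∣
  (euclidsLemma ℤ.∣ x ∣ ℤ.∣ y ∣ p-prime (subst (p ∣_) (ℤ.abs-* x y) (ℤ∣.∣⇒∣ᵤ p∣xy)))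

≡0[mod]⇒∣ : ∀ {n} x → x ≡ + 0 [mod n ] → + n ℤ∣.∣ x
≡0[mod]⇒∣ {n} x = subst (+ n ℤ∣.∣_) (ℤ.+-identityʳ x)

∣⇒≡0[mod] : ∀ {n} x → + n ℤ∣.∣ x → x ≡ + 0 [mod n ]
∣⇒≡0[mod] {n} x = subst (+ n ℤ∣.∣_) (sym (ℤ.+-identityʳ x))

-- The edges of the zero-divisor graph modulo `2 * q`.

-- With q a variable rather than suc (suc m), Agda never compares two unfoldings of Γ (2 * q).
module Edges (q m : ℕ) (q≡2+m : q ≡ suc (suc m)) (q-prime : Prime q) (q-odd : ¬ (2 ∣ q)) where
  private
    instance
      q-nonZero : ℕ.NonZero q
      q-nonZero = prime⇒nonZero q-prime

  2∣2q : + 2 ℤ∣.∣ + (2 * q)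
  2∣2q = ℤ∣.∣ᵤ⇒∣ (ℕ∣.m∣m*n q)

  q∣2q : + q ℤ∣.∣ + (2 * q)
  q∣2q = ℤ∣.∣ᵤ⇒∣ (ℕ∣.n∣m*n 2)

  2∤q : ¬ (+ 2 ℤ∣.∣ + q)
  2∤q = q-odd ∘ ℤ∣.∣⇒∣ᵤ

  -- Coprimality of 2 and `q`: writing `x` as `k` times `q`, Euclid's lemma for 2 forces 2 to divide
  -- `k`, since `q` is odd.
  2q∣ : ∀ {x} → + 2 ℤ∣.∣ x → + q ℤ∣.∣ x → + (2 * q) ℤ∣.∣ x
  2q∣ 2∣x (ℤ∣.divides k refl) with euclidsLemmaℤ prime[2] k (+ q) 2∣x
  ... | inj₁ (ℤ∣.divides l refl) = ℤ∣.divides l (trans (ℤ.*-assoc l (+ 2) (+ q)) (cong (l *ℤ_) (sym (ℤ.pos-* 2 q))))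
  ... | inj₂ 2∣q                 = contradiction 2∣q 2∤q

  2q∣2x⇒q∣x : ∀ {x} → 2 * q ∣ 2 * x → q ∣ x
  2q∣2x⇒q∣x = ℕ∣.*-cancelˡ-∣ 2

  even*q≈0 : ∀ k → + (2 * k) *ℤ + q ≡ + 0 [mod 2 * q ]
  even*q≈0 k = ∣⇒≡0[mod] (+ (2 * k) *ℤ + q) (ℤ∣.∣ᵤ⇒∣ (subst (2 * q ∣_) eq (ℕ∣.n∣m*n k)))
    where
    eq : k * (2 * q) ≡ ℤ.∣ + (2 * k) *ℤ + q ∣
    eq = begin
      k * (2 * q)                 ≡⟨ ℕ.*-assoc k 2 q ⟨
      k * 2 * q                   ≡⟨ cong (_* q) (ℕ.*-comm k 2) ⟩
      2 * k * q                   ≡⟨ ℤ.abs-* (+ (2 * k)) (+ q) ⟨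
      ℤ.∣ + (2 * k) *ℤ + q ∣      ∎

  q*even≈0 : ∀ k → + q *ℤ + (2 * k) ≡ + 0 [mod 2 * q ]
  q*even≈0 k = subst (_≡ + 0 [mod 2 * q ]) (ℤ.*-comm (+ (2 * k)) (+ q)) (even*q≈0 k)

  even≉0 : ∀ {k} .{{_ : ℕ.NonZero k}} → k ℕ.< q → ¬ (+ (2 * k) ≡ + 0 [mod 2 * q ])
  even≉0 {k} k<q = ℕ∣.>⇒∤ k<q ∘ 2q∣2x⇒q∣x ∘ ℤ∣.∣⇒∣ᵤ ∘ ≡0[mod]⇒∣ (+ (2 * k))

  q≉0 : ¬ (+ q ≡ + 0 [mod 2 * q ])
  q≉0 = 2∤q ∘ ℤ∣.∣-trans 2∣2q ∘ ≡0[mod]⇒∣ (+ q)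

  -- By parity, as the modulus is even. This makes the centre distinct from every leaf, and later
  -- excludes matching two spokes with their ends swapped.
  q≉even : ∀ k → ¬ (+ q ≡ + (2 * k) [mod 2 * q ])
  q≉even k 2q∣ = 2∤q (ℤ∣.∣m+n∣n⇒∣m {m = + q} (ℤ∣.∣-trans 2∣2q 2q∣)
    (ℤ∣.∣m⇒∣-m (ℤ∣.∣ᵤ⇒∣ {+ 2} {+ (2 * k)} (ℕ∣.m∣m*n k))))

  even-cancel : ∀ {a b} → a ℕ.< q → b ℕ.< q → + (2 * a) ≡ + (2 * b) [mod 2 * q ] → a ≡ b
  even-cancel {a} {b} a<q b<q 2q∣ = ∣-difference⇒≡ a<q b<q
    (ℤ∣.*-cancelˡ-∣ (+ 2) (subst₂ ℤ∣._∣_ (ℤ.pos-* 2 q) eq 2q∣))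
    where
    eq : + (2 * a) - + (2 * b) ≡ + 2 *ℤ (+ a - + b)
    eq = trans (cong₂ _-_ (ℤ.pos-* 2 a) (ℤ.pos-* 2 b)) (lem (+ a) (+ b))
      where
      open ℤ-Solver.+-*-Solver
      lem : ∀ a b → + 2 *ℤ a - + 2 *ℤ b ≡ + 2 *ℤ (a - b)
      lem = solve 2 (λ a b → con (+ 2) :* a :- con (+ 2) :* b := con (+ 2) :* (a :- b)) refl

  1<q : 1 ℕ.< q
  1<q = subst (1 ℕ.<_) (sym q≡2+m) (ℕ.s≤s (ℕ.s≤s ℕ.z≤n))

  center : Graph.V (Γ (2 * q))
  -- The annihilating witness 2 is the even residue `2 * 1`, nonzero because `1 < q`.
  center = + q , q≉0 , + 2 , even≉0 {1} 1<q , q*even≈0 1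

  leaf< : ∀ (i : Fin (suc m)) → suc (toℕ i) ℕ.< q
  leaf< i = subst (suc (toℕ i) ℕ.<_) (sym q≡2+m) (ℕ.s≤s (Fin.toℕ<n i))

  -- The shift by `suc` skips the residue 0: the leaves are 2, 4, up to `2 * (q - 1)`.
  leaf : Fin (suc m) → Graph.V (Γ (2 * q))
  leaf i = + (2 * suc (toℕ i)) , even≉0 (leaf< i) , + q , q≉0 , even*q≈0 (suc (toℕ i))

  spoke : Fin (suc m) → Edge (Γ (2 * q))
  spoke i = edge center (leaf i) (q≉even (suc (toℕ i)) , q*even≈0 (suc (toℕ i)))

  spoke-injective : ∀ {i j} → _≈ₑ_ (Γ (2 * q)) (spoke i) (spoke j) → i ≡ j
  spoke-injective {i} {j} (inj₁ (_ , leafᵢ≈leafⱼ)) =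
    Fin.toℕ-injective (ℕ.suc-injective (even-cancel (leaf< i) (leaf< j) leafᵢ≈leafⱼ))
  spoke-injective {i} {j} (inj₂ (center≈leafⱼ , _)) = contradiction center≈leafⱼ (q≉even (suc (toℕ j)))

  -- If `x` were even it would be divisible by both 2 and `q`, hence zero. So `x` is odd, and
  -- `q - x` is divisible by 2 and by `q`.
  ≈center : ∀ {x} → ¬ (x ≡ + 0 [mod 2 * q ]) → + q ℤ∣.∣ x → + q ≡ x [mod 2 * q ]
  ≈center {x} x≉0 q∣x = 2q∣
    (odd-odd⇒even (+ q) x 2∤q (λ 2∣x → x≉0 (∣⇒≡0[mod] x (2q∣ 2∣x q∣x))))
    (ℤ∣.∣m∣n⇒∣m-n ℤ∣.∣-refl q∣x)

  -- Halve `y` to `t` and reduce `t` modulo `q`. Remainder 0 would make `y` zero; remainder `suc r`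
  -- singles out the leaf with index `r`.
  ≈leaf : ∀ {y} → ¬ (y ≡ + 0 [mod 2 * q ]) → + 2 ℤ∣.∣ y →
    ∃[ i ] + (2 * suc (toℕ i)) ≡ y [mod 2 * q ]
  ≈leaf y≉0 (ℤ∣.divides t refl) with t ℤ.%ℕ q | ℤ.n%ℕd<d t q | ℤ.a≡a%ℕn+[a/ℕn]*n t q
  ... | zero  | _     | t≡ = contradiction
        (∣⇒≡0[mod] (t *ℤ + 2) (2q∣ (ℤ∣.∣n⇒∣m*n t ℤ∣.∣-refl)
          (ℤ∣.∣m⇒∣m*n (+ 2) (ℤ∣.divides (t ℤ./ℕ q) (trans t≡ (ℤ.+-identityˡ _)))))) y≉0
  -- Doubling the remainder and subtracting `y` leaves minus the quotient of `t` by `q`, times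
  -- `2 * q`; hence the negated witness.
  ... | suc r | 1+r<q | t≡ = fromℕ< r<1+m , ℤ∣.divides (ℤ.- (t ℤ./ℕ q)) eq
    where
    r<1+m : r ℕ.< suc m
    r<1+m = ℕ.s<s⁻¹ (subst (suc r ℕ.<_) q≡2+m 1+r<q)
    open ℤ-Solver.+-*-Solver
    lem : ∀ r s q → + 2 *ℤ r - (r ℤ.+ s *ℤ q) *ℤ + 2 ≡ ℤ.- s *ℤ (+ 2 *ℤ q)
    lem = solve 3 (λ r s q → con (+ 2) :* r :- (r :+ s :* q) :* con (+ 2) := :- s :* (con (+ 2) :* q)) refl
    eq : + (2 * suc (toℕ (fromℕ< r<1+m))) - t *ℤ + 2 ≡ ℤ.- (t ℤ./ℕ q) *ℤ + (2 * q)
    eq = begin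
      + (2 * suc (toℕ (fromℕ< r<1+m))) - t *ℤ + 2
        ≡⟨ cong₂ (λ i u → + (2 * suc i) - u *ℤ + 2) (Fin.toℕ-fromℕ< r<1+m) t≡ ⟩
      + (2 * suc r) - (+ suc r ℤ.+ (t ℤ./ℕ q) *ℤ + q) *ℤ + 2
        ≡⟨ cong (_- (+ suc r ℤ.+ (t ℤ./ℕ q) *ℤ + q) *ℤ + 2) (ℤ.pos-* 2 (suc r)) ⟩
      + 2 *ℤ + suc r - (+ suc r ℤ.+ (t ℤ./ℕ q) *ℤ + q) *ℤ + 2
        ≡⟨ lem (+ suc r) (t ℤ./ℕ q) (+ q) ⟩
      ℤ.- (t ℤ./ℕ q) *ℤ (+ 2 *ℤ + q)
        ≡⟨ cong (ℤ.- (t ℤ./ℕ q) *ℤ_) (ℤ.pos-* 2 q) ⟨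
      ℤ.- (t ℤ./ℕ q) *ℤ + (2 * q) ∎

  -- Each of 2 and `q` divides one of the two ends. If both divided the same end, it would be zero.
  -- So one end is the centre and the other a leaf, in either order.
  spoke-surjective : ∀ e → ∃[ i ] _≈ₑ_ (Γ (2 * q)) (spoke i) e
  spoke-surjective (edge (x , x≉0 , _) (y , y≉0 , _) (_ , xy≈0))
    with euclidsLemmaℤ prime[2] x y (ℤ∣.∣-trans 2∣2q (≡0[mod]⇒∣ (x *ℤ y) xy≈0))
       | euclidsLemmaℤ q-prime  x y (ℤ∣.∣-trans q∣2q (≡0[mod]⇒∣ (x *ℤ y) xy≈0))
  ... | inj₁ 2∣x | inj₁ q∣x = contradiction (∣⇒≡0[mod] x (2q∣ 2∣x q∣x)) x≉0
  ... | inj₂ 2∣y | inj₂ q∣y = contradiction (∣⇒≡0[mod] y (2q∣ 2∣y q∣y)) y≉0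
  ... | inj₂ 2∣y | inj₁ q∣x = let i , leaf≈y = ≈leaf y≉0 2∣y in i , inj₁ (≈center x≉0 q∣x , leaf≈y)
  ... | inj₁ 2∣x | inj₂ q∣y = let i , leaf≈x = ≈leaf x≉0 2∣x in i , inj₂ (≈center y≉0 q∣y , leaf≈x)

  private
    module L = DecSetoid (Graph.vertices (lineGraph (Γ (2 * q))))

  enumeration : Enumeration (lineGraph (Γ (2 * q))) (suc m)
  enumeration = Bijection⇒Inverse record
    { to        = spoke
    ; cong      = λ { {i} refl → L.refl {spoke i} }
    ; bijective = spoke-injective
                , λ e → let i , i≈e = spoke-surjective e in i , λ { refl → i≈e }
    }

  spokes-adjacent : ∀ {i j} → i ≢ j → Graph._~_ (lineGraph (Γ (2 * q))) (spoke i) (spoke j)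
  spokes-adjacent i≢j = i≢j ∘ spoke-injective
    , center , inj₁ center-refl , inj₁ center-refl
    where
    center-refl = DecSetoid.refl (Graph.vertices (Γ (2 * q))) {center}

  -- Keeping `E` a variable lets a propositional equality with `m + m` be discharged by matching on
  -- `refl`.
  lineGraph-energy : ∀ E → E ≡ + (m ℕ.+ m) → HasEnergy (lineGraph (Γ (2 * q))) (fromℤ E)
  lineGraph-energy _ refl = complete-energy (lineGraph (Γ (2 * q))) enumeration spokes-adjacent

theorem3p1 : ∀ (q : ℕ) → Prime q → ¬ (2 ∣ q) → HasEnergy (lineGraph (Γ (2 * q))) (fromℤ ((+ 2 *ℤ + q) - + 4))
theorem3p1 0 q-prime _ = contradiction q-prime ¬prime[0]
theorem3p1 1 q-prime _ = contradiction q-prime ¬prime[1]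
theorem3p1 (suc (suc m)) q-prime q-odd =
  Edges.lineGraph-energy (suc (suc m)) m refl q-prime q-odd ((+ 2 *ℤ + suc (suc m)) - + 4) (lem (+ m))
  where
  open ℤ-Solver.+-*-Solver
  -- At `+ m` the inner sum computes to `+ suc (suc m)` and the right side to `+ (m ℕ.+ m)`, which
  -- is the equation required with `q` equal to `m + 2`.
  lem : ∀ m → + 2 *ℤ (+ 2 ℤ.+ m) - + 4 ≡ m ℤ.+ m
  lem = solve 1 (λ m → con (+ 2) :* (con (+ 2) :+ m) :- con (+ 4) := m :+ m) refl
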